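{- No rational prime $p\in\mathbb{Z}$ is a prime of $H_{1,2,2}$.
   Context: Let $\mathbf{i},\mathbf{j},\mathbf{k}$ be the standard quaternion units. $H_{1,2,2}$ is the subring of the quaternions equal to the $\mathbb{Z}$-module generated by $\mathbf{v}_1=1$, $\mathbf{v}_2=\mathbf{i}$, $\mathbf{v}_3=\tfrac12(1+\mathbf{i}+\sqrt2\,\mathbf{j})$, $\mathbf{v}_4=\tfrac12(1+\mathbf{i}+\sqrt2\,\mathbf{k})$. A unit is an element invertible in $H_{1,2,2}$. A prime of $H_{1,2,2}$ is a nonzero nonunit $\boldsymbol\pi$ such that whenever $\boldsymbol\pi=\mathbf{a}\mathbf{b}$ with $\mathbf{a},\mathbf{b}\in H_{1,2,2}$, at least one of $\mathbf{a},\mathbf{b}$ is a unit. -}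

module Defs where

open import Data.Integer.Base as ℤ using (ℤ)
open import Data.Product.Base using (_×_; ∃-syntax)
open import Data.Rational.Base as ℚ using (ℚ; 0ℚ; 1ℚ; ½)
open import Data.Sum.Base using (_⊎_)
open import Relation.Binary.PropositionalEquality.Core using (_≡_; _≢_; refl)
open import Relation.Nullary.Negation.Core using (¬_)

-- The real field ℚ(√2), used as scalar field in place of ℝ: it contains
-- all the coordinates of the quaternions considered below.  The
-- representation is unique, so propositional equality is field equality.

record ℚ√2 : Set where
  constructor _+_·√2
  field
    rat irr : ℚ

infix  8 -ₖ_
infixl 7 _*ₖ_
infixl 6 _+ₖ_ _-ₖ_

_+ₖ_ : ℚ√2 → ℚ√2 → ℚ√2
(a + b ·√2) +ₖ (c + d ·√2) = (a ℚ.+ c) + (b ℚ.+ d) ·√2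

-ₖ_ : ℚ√2 → ℚ√2
-ₖ (a + b ·√2) = (ℚ.- a) + (ℚ.- b) ·√2

_-ₖ_ : ℚ√2 → ℚ√2 → ℚ√2
x -ₖ y = x +ₖ (-ₖ y)

_*ₖ_ : ℚ√2 → ℚ√2 → ℚ√2
(a + b ·√2) *ₖ (c + d ·√2) =
  (a ℚ.* c ℚ.+ (1ℚ ℚ.+ 1ℚ) ℚ.* (b ℚ.* d)) + (a ℚ.* d ℚ.+ b ℚ.* c) ·√2

fromℚ : ℚ → ℚ√2
fromℚ q = q + 0ℚ ·√2

0ₖ 1ₖ √2 : ℚ√2
0ₖ = fromℚ 0ℚ
1ₖ = fromℚ 1ℚ
√2 = 0ℚ + 1ℚ ·√2

√2*√2≡2 : √2 *ₖ √2 ≡ 1ₖ +ₖ 1ₖ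
√2*√2≡2 = refl

-- ⟨ a , b , c , d ⟩ stands for a + b 𝐢 + c 𝐣 + d 𝐤.

record ℍ : Set where
  constructor ⟨_,_,_,_⟩
  field
    re im-i im-j im-k : ℚ√2

infixl 7 _*_ _·_
infixl 6 _+_

_+_ : ℍ → ℍ → ℍ
⟨ a , b , c , d ⟩ + ⟨ a′ , b′ , c′ , d′ ⟩ =
  ⟨ a +ₖ a′ , b +ₖ b′ , c +ₖ c′ , d +ₖ d′ ⟩

_*_ : ℍ → ℍ → ℍ
⟨ a , b , c , d ⟩ * ⟨ a′ , b′ , c′ , d′ ⟩ =
  ⟨ a *ₖ a′ -ₖ b *ₖ b′ -ₖ c *ₖ c′ -ₖ d *ₖ d′
  , a *ₖ b′ +ₖ b *ₖ a′ +ₖ c *ₖ d′ -ₖ d *ₖ c′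
  , a *ₖ c′ -ₖ b *ₖ d′ +ₖ c *ₖ a′ +ₖ d *ₖ b′
  , a *ₖ d′ +ₖ b *ₖ c′ -ₖ c *ₖ b′ +ₖ d *ₖ a′
  ⟩

_·_ : ℚ√2 → ℍ → ℍ
x · ⟨ a , b , c , d ⟩ = ⟨ x *ₖ a , x *ₖ b , x *ₖ c , x *ₖ d ⟩

𝟎 𝟏 𝐢 𝐣 𝐤 : ℍ
𝟎 = ⟨ 0ₖ , 0ₖ , 0ₖ , 0ₖ ⟩
𝟏 = ⟨ 1ₖ , 0ₖ , 0ₖ , 0ₖ ⟩
𝐢 = ⟨ 0ₖ , 1ₖ , 0ₖ , 0ₖ ⟩
𝐣 = ⟨ 0ₖ , 0ₖ , 1ₖ , 0ₖ ⟩
𝐤 = ⟨ 0ₖ , 0ₖ , 0ₖ , 1ₖ ⟩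

infixl 7 _·ℤ_

_·ℤ_ : ℤ → ℍ → ℍ
n ·ℤ x = fromℚ (n ℚ./ 1) · x

fromℤ : ℤ → ℍ
fromℤ n = n ·ℤ 𝟏

v₁ v₂ v₃ v₄ : ℍ
v₁ = 𝟏
v₂ = 𝐢
v₃ = fromℚ ½ · (𝟏 + 𝐢 + √2 · 𝐣)
v₄ = fromℚ ½ · (𝟏 + 𝐢 + √2 · 𝐤)

infix 4 _∈H₁₂₂

_∈H₁₂₂ : ℍ → Set
x ∈H₁₂₂ = ∃[ a ] ∃[ b ] ∃[ c ] ∃[ d ]
  x ≡ a ·ℤ v₁ + b ·ℤ v₂ + c ·ℤ v₃ + d ·ℤ v₄

-- Inverses are required to lie in H₁₂₂, not merely in ℍ.

IsUnit : ℍ → Set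
IsUnit x = x ∈H₁₂₂ × ∃[ y ] y ∈H₁₂₂ × x * y ≡ 𝟏 × y * x ≡ 𝟏

record IsPrime (π : ℍ) : Set where
  field
    member  : π ∈H₁₂₂
    nonzero : π ≢ 𝟎
    nonunit : ¬ IsUnit π
    split   : ∀ a b → a ∈H₁₂₂ → b ∈H₁₂₂ → π ≡ a * b → IsUnit a ⊎ IsUnit b

{-# OPTIONS --safe #-}

-- An element of prime norm p gives the factorisation p = α ᾱ into nonunits, so
-- it suffices that the norm form of H₁₂₂ represents p.  By the pigeonhole
-- principle some α = x + 𝐢 + y √2 𝐣 has norm m p with 0 < m < p.  If m > 1, then
-- m lowers: H₁₂₂ is norm-Euclidean, so there are γ and β = α − m γ with
-- N(β) ≤ ¾ m².  Now N(β) = m m′ with m′ = p − Tr(α γ̄) + m N(γ), hence m′ < m, and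
-- p − α γ̄ = α β̄ / m has norm m′ p.  Finally m′ ≠ 0, since β = 0 would give m ∣ p.

module Submission where

open import Data.Empty using (⊥; ⊥-elim)
open import Data.Integer.Base using (ℤ; +_; -[1+_]; ∣_∣; 1ℤ; -1ℤ)
import Data.Integer.Base as ℤ
import Data.Integer.Properties as ℤ
import Data.Integer.Tactic.RingSolver as ℤ
open import Data.Nat.Base using (ℕ; zero)
import Data.Nat.Base as ℕ
open import Data.Nat.Primality using (Prime; prime⇒irreducible; euclidsLemma; ¬prime[1])
import Data.Nat.Properties as ℕ
open import Data.Product.Base using (∃-syntax; _×_; _,_; proj₁; proj₂)
open import Data.Sum.Base using (_⊎_; inj₁; inj₂; [_,_]′)
open import Function.Base using (_∘_)
open import Relation.Binary.PropositionalEquality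
open import Relation.Nullary.Negation.Core using (¬_; contradiction)
open import Defs hiding (_+_; _*_)
import Defs as ℍ

-- Integer coordinates: conjugation, product and norm form.

module Integral where

  open import Data.Fin.Base as Fin using (Fin; toℕ; fromℕ<; splitAt; join)
  import Data.Fin.Properties as Fin
  open import Data.Integer.Base hiding (suc; _%_)
  open import Data.Integer.Divisibility.Signed
    using (_∣_; divides; ∣⇒∣ᵤ; ∣ᵤ⇒∣; ∣m∣n⇒∣m-n; ∣m∣n⇒∣m+n; ∣m⇒∣-m; ∣n⇒∣m*n; ∣-refl)
  open import Data.Integer.DivMod using (_%ℕ_; _/ℕ_; n%ℕd<d; a≡a%ℕn+[a/ℕn]*n)
  open import Data.Integer.Properties
  open import Data.Integer.Tactic.RingSolver using (solve-∀)
  open import Data.Nat.Base using (suc; s≤s; z≤n; s<s; z<s)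
  import Data.Nat.Divisibility as ℕ
  open import Data.Nat.DivMod using (_%_; m≡m%n+[m/n]*n; m%n<n)
  open import Data.Nat.Induction using (Acc; acc; <-wellFounded)
  import Data.Nat.Tactic.RingSolver as ℕ

  -- Coordinates in the basis v₁, v₂, v₃, v₄, so that everything up to the descent is arithmetic in
  -- ℤ; `embed` passes to quaternions.
  record Coords : Set where
    constructor coords
    field c₁ c₂ c₃ c₄ : ℤ

  infixl 7 _•_ _⊠_
  infixl 6 _⊟_

  _•_ : ℤ → Coords → Coords
  m • coords a b c d = coords (m * a) (m * b) (m * c) (m * d)

  _⊟_ : Coords → Coords → Coords
  coords a b c d ⊟ coords e f g h = coords (a - e) (b - f) (c - g) (d - h)

  -- The conjugates of v₃ and v₄ are v₁ - v₃ and v₁ - v₄, whence c + d in the first coordinate.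
  conj : Coords → Coords
  conj (coords a b c d) = coords (a + c + d) (- b) (- c) (- d)

  -- Products of the basis elements: v₂v₃ = v₄ − v₁, v₃v₂ = v₂ − v₄, v₂v₄ = v₂ − v₃,
  -- v₄v₂ = v₃ − v₁, v₃² = v₃ − v₁, v₄² = v₄ − v₁, v₃v₄ = v₂, v₄v₃ = v₃ + v₄ − v₁ − v₂.
  _⊠_ : Coords → Coords → Coords
  coords a b c d ⊠ coords e f g h = coords
    (a * e - b * f - b * g - c * g - d * f - d * g - d * h)
    (a * f + b * e + b * h + c * f + c * h - d * g)
    (a * g - b * h + c * e + c * g + d * f + d * g)
    (a * h + b * g - c * f + d * e + d * g + d * h)

  norm : Coords → ℤ
  norm (coords a b c d) =
    a * a + b * b + (a + b) * (c + d) + c * c + c * d + d * d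

  -- The bilinear form N(x + y) - N(x) - N(y), which is the trace of x ȳ.
  polar : Coords → Coords → ℤ
  polar (coords a b c d) (coords e f g h) =
    + 2 * a * e + + 2 * b * f + (a + b) * (g + h) + (e + f) * (c + d) +
    + 2 * c * g + + 2 * d * h + c * h + d * g

  norm-• : ∀ m x → norm (m • x) ≡ m * (m * norm x)
  norm-• m (coords a b c d) = lemma m a b c d
    where
    -- The `let` spells the norm form out, so that the ring solver meets ring operations only.
    lemma : ∀ m a b c d →
      let q = λ a b c d → a * a + b * b + (a + b) * (c + d) + c * c + c * d + d * d in
      q (m * a) (m * b) (m * c) (m * d) ≡ m * (m * q a b c d)
    lemma = solve-∀

  norm-conj : ∀ x → norm (conj x) ≡ norm x
  norm-conj (coords a b c d) = lemma a b c d
    where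
    lemma : ∀ a b c d →
      let q = λ a b c d → a * a + b * b + (a + b) * (c + d) + c * c + c * d + d * d in
      q (a + c + d) (- b) (- c) (- d) ≡ q a b c d
    lemma = solve-∀

  -- Polarisation. Every term after the first carries a factor m, so if m divides N(x), it also
  -- divides the norm of the remainder x - m y.
  norm-⊟• : ∀ m x y → norm (x ⊟ m • y) ≡ norm x + m * (m * norm y - polar x y)
  norm-⊟• m (coords a b c d) (coords e f g h) = lemma m a b c d e f g h
    where
    lemma : ∀ m a b c d e f g h →
      let q = λ a b c d → a * a + b * b + (a + b) * (c + d) + c * c + c * d + d * d in
      q (a - m * e) (b - m * f) (c - m * g) (d - m * h) ≡
      q a b c d + m * (m * q e f g h -
        (+ 2 * a * e + + 2 * b * f + (a + b) * (g + h) + (e + f) * (c + d) +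
         + 2 * c * g + + 2 * d * h + c * h + d * g))
    lemma = solve-∀

  -- When norm x = m p, the element on the left is x ⊠ conj (x ⊟ m • y) divided by m.
  norm-⊟⊠conj : ∀ p x y →
    norm (coords p 0ℤ 0ℤ 0ℤ ⊟ x ⊠ conj y) ≡ norm x * norm y + p * (p - polar x y)
  norm-⊟⊠conj p (coords a b c d) (coords e f g h) = lemma p a b c d e f g h
    where
    lemma : ∀ p a b c d e f g h →
      let q = λ a b c d → a * a + b * b + (a + b) * (c + d) + c * c + c * d + d * d
          e′ = e + g + h ; f′ = - f ; g′ = - g ; h′ = - h
      in
      q (p - (a * e′ - b * f′ - b * g′ - c * g′ - d * f′ - d * g′ - d * h′))
        (0ℤ - (a * f′ + b * e′ + b * h′ + c * f′ + c * h′ - d * g′))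
        (0ℤ - (a * g′ - b * h′ + c * e′ + c * g′ + d * f′ + d * g′))
        (0ℤ - (a * h′ + b * g′ - c * f′ + d * e′ + d * g′ + d * h′)) ≡
      q a b c d * q e f g h + p * (p -
        (+ 2 * a * e + + 2 * b * f + (a + b) * (g + h) + (e + f) * (c + d) +
         + 2 * c * g + + 2 * d * h + c * h + d * g))
    lemma = solve-∀

  -- Positive definiteness by completing squares.

  -- This is 4 (i + s/2)², free of denominators. One shape for all four coordinates lets
  -- `centred-remainder` treat them alike.
  shiftedSquare : ℤ → ℤ → ℤ
  shiftedSquare i s = (+ 2 * i + s) * (+ 2 * i + s)

  -- The weights come from scaling by 8: (a + (c + d)/2)² becomes two shifted squares, 2 (c/2)²
  -- becomes one.
  completed : ℤ → ℤ → ℤ → ℤ → ℤ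
  completed i j k l = + 2 * i + + 2 * j + k + l

  -- The coordinates along 1, 𝐢, √2 𝐣, √2 𝐤 are a + (c + d)/2, b + (c + d)/2, c/2, d/2.
  8norm : ∀ a b c d → + 8 * norm (coords a b c d) ≡
    completed (shiftedSquare a (c + d)) (shiftedSquare b (c + d))
              (shiftedSquare c 0ℤ) (shiftedSquare d 0ℤ)
  8norm = lemma
    where
    lemma : ∀ a b c d →
      let sq = λ i s → (+ 2 * i + s) * (+ 2 * i + s) in
      + 8 * (a * a + b * b + (a + b) * (c + d) + c * c + c * d + d * d) ≡
      + 2 * sq a (c + d) + + 2 * sq b (c + d) + sq c 0ℤ + sq d 0ℤ
    lemma = solve-∀

  0≤i*i : ∀ i → 0ℤ ≤ i * i
  0≤i*i (+ n)    = subst (0ℤ ≤_) (pos-* n n) (+≤+ z≤n)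
  0≤i*i -[1+ n ] = +≤+ z≤n

  0≤shiftedSquare : ∀ i s → 0ℤ ≤ shiftedSquare i s
  0≤shiftedSquare i s = 0≤i*i (+ 2 * i + s)

  shiftedSquare≡0⇒≡0 : ∀ i → shiftedSquare i 0ℤ ≡ 0ℤ → i ≡ 0ℤ
  shiftedSquare≡0⇒≡0 i eq =
    *-cancelˡ-≡ (+ 2) i 0ℤ (trans (sym (+-identityʳ (+ 2 * i))) (i*i≡0⇒i≡0 (+ 2 * i + 0ℤ) eq))
    where
    i*i≡0⇒i≡0 : ∀ i → i * i ≡ 0ℤ → i ≡ 0ℤ
    i*i≡0⇒i≡0 i eq with i*j≡0⇒i≡0∨j≡0 i eq
    ... | inj₁ i≡0 = i≡0
    ... | inj₂ i≡0 = i≡0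

  completed-mono-≤ : ∀ {i j k l i′ j′ k′ l′} → i ≤ i′ → j ≤ j′ → k ≤ k′ → l ≤ l′ →
    completed i j k l ≤ completed i′ j′ k′ l′
  completed-mono-≤ i≤ j≤ k≤ l≤ =
    +-mono-≤ (+-mono-≤ (+-mono-≤ (*-monoˡ-≤-nonNeg (+ 2) i≤) (*-monoˡ-≤-nonNeg (+ 2) j≤)) k≤) l≤

  completed≡0⇒≡0 : ∀ {i j k l} → 0ℤ ≤ i → 0ℤ ≤ j → 0ℤ ≤ k → 0ℤ ≤ l →
    completed i j k l ≡ 0ℤ → i ≡ 0ℤ × j ≡ 0ℤ × k ≡ 0ℤ × l ≡ 0ℤ
  completed≡0⇒≡0 {i} {j} {k} {l} 0≤i 0≤j 0≤k 0≤l eq =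
    half i (proj₁ (split 0≤2i 0≤2j ij≡0)) ,
    half j (proj₂ (split 0≤2i 0≤2j ij≡0)) ,
    proj₂ (split 0≤ij 0≤k ijk≡0) ,
    proj₂ (split (+-mono-≤ 0≤ij 0≤k) 0≤l eq)
    where
    split : ∀ {i j} → 0ℤ ≤ i → 0ℤ ≤ j → i + j ≡ 0ℤ → i ≡ 0ℤ × j ≡ 0ℤ
    split {+ m} {+ n} _ _ eq =
      cong +_ (ℕ.m+n≡0⇒m≡0 m (+-injective eq)) ,
      cong +_ (ℕ.m+n≡0⇒n≡0 m (+-injective eq))
    half : ∀ i → + 2 * i ≡ 0ℤ → i ≡ 0ℤ
    half i = *-cancelˡ-≡ (+ 2) i 0ℤ
    0≤2i : 0ℤ ≤ + 2 * i
    0≤2i = *-monoˡ-≤-nonNeg (+ 2) 0≤i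
    0≤2j : 0ℤ ≤ + 2 * j
    0≤2j = *-monoˡ-≤-nonNeg (+ 2) 0≤j
    0≤ij : 0ℤ ≤ + 2 * i + + 2 * j
    0≤ij = +-mono-≤ 0≤2i 0≤2j
    ijk≡0 : + 2 * i + + 2 * j + k ≡ 0ℤ
    ijk≡0 = proj₁ (split (+-mono-≤ 0≤ij 0≤k) 0≤l eq)
    ij≡0 : + 2 * i + + 2 * j ≡ 0ℤ
    ij≡0 = proj₁ (split 0≤ij 0≤k ijk≡0)

  norm-nonNeg : ∀ x → 0ℤ ≤ + 8 * norm x
  norm-nonNeg (coords a b c d) = subst (0ℤ ≤_) (sym (8norm a b c d))
    (completed-mono-≤ {0ℤ} {0ℤ} {0ℤ} {0ℤ}
      (0≤shiftedSquare a (c + d)) (0≤shiftedSquare b (c + d))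
      (0≤shiftedSquare c 0ℤ) (0≤shiftedSquare d 0ℤ))

  -- The last two squares force c = d = 0, which removes the shift c + d from the first two.
  norm-definite : ∀ x → norm x ≡ 0ℤ → x ≡ coords 0ℤ 0ℤ 0ℤ 0ℤ
  norm-definite (coords a b c d) eq = conclude (completed≡0⇒≡0
    (0≤shiftedSquare a (c + d)) (0≤shiftedSquare b (c + d))
    (0≤shiftedSquare c 0ℤ) (0≤shiftedSquare d 0ℤ)
    (trans (sym (8norm a b c d)) (cong (+ 8 *_) eq)))
    where
    substituted : ∀ {c d} → c ≡ 0ℤ → d ≡ 0ℤ →
      shiftedSquare a (c + d) ≡ 0ℤ → shiftedSquare b (c + d) ≡ 0ℤ →
      coords a b c d ≡ coords 0ℤ 0ℤ 0ℤ 0ℤ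
    substituted refl refl a≡ b≡ =
      cong₂ (λ a b → coords a b 0ℤ 0ℤ) (shiftedSquare≡0⇒≡0 a a≡) (shiftedSquare≡0⇒≡0 b b≡)
    conclude : shiftedSquare a (c + d) ≡ 0ℤ × shiftedSquare b (c + d) ≡ 0ℤ ×
      shiftedSquare c 0ℤ ≡ 0ℤ × shiftedSquare d 0ℤ ≡ 0ℤ →
      coords a b c d ≡ coords 0ℤ 0ℤ 0ℤ 0ℤ
    conclude (a≡ , b≡ , c≡ , d≡) =
      substituted (shiftedSquare≡0⇒≡0 c c≡) (shiftedSquare≡0⇒≡0 d d≡) a≡ b≡

  -- Euclidean division with respect to the norm.

  -- Rounding to the nearest is floor division after a shift: 2 i + s + m = k + 2 m q with 0 ≤ k < 2
  -- m gives 2 (i - m q) + s = k - m, which lies between -m and m.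
  centred-remainder : ∀ m .{{_ : ℕ.NonZero m}} i s →
    ∃[ q ] shiftedSquare (i - + m * q) s ≤ + m * + m
  centred-remainder m i s = q , (begin
    shiftedSquare (i - + m * q) s                        ≡⟨ cong (λ r → r * r) r≡k-m ⟩
    (+ k - + m) * (+ k - + m)                            ≤⟨ i≤i+j _ (+ (k ℕ.* j)) ⟩
    (+ k - + m) * (+ k - + m) + + (k ℕ.* j)
      ≡⟨ cong (λ n → (+ k - + m) * (+ k - + m) + n) k*j≡ ⟩
    (+ k - + m) * (+ k - + m) + + k * (+ 2 * + m - + k)  ≡⟨ square (+ k) (+ m) ⟩
    + m * + m                                            ∎)
    where
    open ≤-Reasoning
    instance
      2m≢0 : ℕ.NonZero (2 ℕ.* m)
      2m≢0 = ℕ.m*n≢0 2 m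
    X q : ℤ
    X = + 2 * i + s + + m
    q = X /ℕ (2 ℕ.* m)
    k j : ℕ
    k = X %ℕ (2 ℕ.* m)
    -- No truncation occurs, since k < 2 m. The natural number k j is exactly the gap m² - (k - m)².
    j = 2 ℕ.* m ℕ.∸ k
    shift : ∀ i s m q → + 2 * (i - m * q) + s ≡ + 2 * i + s + m - q * (+ 2 * m) - m
    shift = solve-∀
    square : ∀ k m → (k - m) * (k - m) + k * (+ 2 * m - k) ≡ m * m
    square = solve-∀
    cancel : ∀ i j → i + j - j ≡ i
    cancel = solve-∀
    r≡k-m : + 2 * (i - + m * q) + s ≡ + k - + m
    r≡k-m = begin-equality
      + 2 * (i - + m * q) + s              ≡⟨ shift i s (+ m) q ⟩
      X - q * (+ 2 * + m) - + m            ≡⟨ cong (λ n → X - q * n - + m) (sym (pos-* 2 m)) ⟩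
      X - q * + (2 ℕ.* m) - + m
        ≡⟨ cong (λ n → n - q * + (2 ℕ.* m) - + m) (a≡a%ℕn+[a/ℕn]*n X (2 ℕ.* m)) ⟩
      + k + q * + (2 ℕ.* m) - q * + (2 ℕ.* m) - + m
        ≡⟨ cong (_- + m) (cancel (+ k) (q * + (2 ℕ.* m))) ⟩
      + k - + m                            ∎
    k*j≡ : + (k ℕ.* j) ≡ + k * (+ 2 * + m - + k)
    k*j≡ = begin-equality
      + (k ℕ.* j)               ≡⟨ pos-* k j ⟩
      + k * + j                 ≡⟨ cong (+ k *_) (sym (⊖-≥ (ℕ.<⇒≤ (n%ℕd<d X (2 ℕ.* m))))) ⟩
      + k * (2 ℕ.* m ⊖ k)       ≡⟨ cong (+ k *_) (sym (m-n≡m⊖n (2 ℕ.* m) k)) ⟩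
      + k * (+ (2 ℕ.* m) - + k) ≡⟨ cong (λ n → + k * (n - + k)) (pos-* 2 m) ⟩
      + k * (+ 2 * + m - + k)   ∎

  -- After rounding each shifted square is at most m², and the weights 2, 2, 1, 1 add up to 6. Hence
  -- the norm of the remainder is at most ¾ m².
  euclidean : ∀ m .{{_ : ℕ.NonZero m}} x →
    ∃[ y ] + 8 * norm (x ⊟ + m • y) ≤ + 6 * (+ m * + m)
  euclidean m (coords a b c d) =
    coords (proj₁ e) (proj₁ f) (proj₁ g) (proj₁ h) ,
    bound (a - + m * proj₁ e) (b - + m * proj₁ f) (c - + m * proj₁ g) (d - + m * proj₁ h)
      (proj₂ e) (proj₂ f) (proj₂ g) (proj₂ h)
    where
    g : ∃[ q ] shiftedSquare (c - + m * q) 0ℤ ≤ + m * + m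
    g = centred-remainder m c 0ℤ
    h : ∃[ q ] shiftedSquare (d - + m * q) 0ℤ ≤ + m * + m
    h = centred-remainder m d 0ℤ
    -- The coordinates c and d are rounded first, because their remainders determine the shift in
    -- the squares for a and b.
    s : ℤ
    s = (c - + m * proj₁ g) + (d - + m * proj₁ h)
    e : ∃[ q ] shiftedSquare (a - + m * q) s ≤ + m * + m
    e = centred-remainder m a s
    f : ∃[ q ] shiftedSquare (b - + m * q) s ≤ + m * + m
    f = centred-remainder m b s
    six : ∀ n → + 2 * n + + 2 * n + n + n ≡ + 6 * n
    six = solve-∀
    bound : ∀ a b c d {n} → shiftedSquare a (c + d) ≤ n → shiftedSquare b (c + d) ≤ n →
      shiftedSquare c 0ℤ ≤ n → shiftedSquare d 0ℤ ≤ n → + 8 * norm (coords a b c d) ≤ + 6 * n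
    bound a b c d {n} a≤ b≤ c≤ d≤ = begin
      + 8 * norm (coords a b c d) ≡⟨ 8norm a b c d ⟩
      completed (shiftedSquare a (c + d)) (shiftedSquare b (c + d))
                (shiftedSquare c 0ℤ) (shiftedSquare d 0ℤ) ≤⟨ completed-mono-≤ a≤ b≤ c≤ d≤ ⟩
      completed n n n n           ≡⟨ six n ⟩
      + 6 * n                     ∎
      where open ≤-Reasoning

  -- Descent on the multiple of p.

  ⊟≡0⇒≡ : ∀ x y → x ⊟ y ≡ coords 0ℤ 0ℤ 0ℤ 0ℤ → x ≡ y
  ⊟≡0⇒≡ (coords a b c d) (coords e f g h) eq
    with i-j≡0⇒i≡j a e (cong Coords.c₁ eq) | i-j≡0⇒i≡j b f (cong Coords.c₂ eq)
       | i-j≡0⇒i≡j c g (cong Coords.c₃ eq) | i-j≡0⇒i≡j d h (cong Coords.c₄ eq)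
  ... | refl | refl | refl | refl = refl

  -- A remainder of norm 0 vanishes, so x = m y and m p = m² N(y); cancelling m leaves p = m N(y).
  norm≡0⇒∣ : ∀ m .{{_ : ℕ.NonZero m}} p x y → norm x ≡ + m * + p →
    norm (x ⊟ + m • y) ≡ 0ℤ → m ℕ.∣ p
  norm≡0⇒∣ m p x y eq remainder≡0 = ℕ.divides ∣ norm y ∣ (begin
    p                     ≡⟨ cong ∣_∣ p≡m*norm ⟩
    ∣ + m * norm y ∣      ≡⟨ abs-* (+ m) (norm y) ⟩
    m ℕ.* ∣ norm y ∣      ≡⟨ ℕ.*-comm m ∣ norm y ∣ ⟩
    ∣ norm y ∣ ℕ.* m      ∎)
    where
    open ≡-Reasoning
    x≡m•y : x ≡ + m • y
    x≡m•y = ⊟≡0⇒≡ x (+ m • y) (norm-definite (x ⊟ + m • y) remainder≡0)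
    p≡m*norm : + p ≡ + m * norm y
    p≡m*norm = *-cancelˡ-≡ (+ m) (+ p) (+ m * norm y)
      (trans (sym eq) (trans (cong norm x≡m•y) (norm-• (+ m) y)))

  -- If k ≥ m, then 8 m ≤ 8 k ≤ 6 m, which is impossible for m > 0.
  quotient-bounds : ∀ m .{{_ : ℕ.NonZero m}} k →
    0ℤ ≤ + 8 * (+ m * k) → + 8 * (+ m * k) ≤ + 6 * (+ m * + m) →
    ∃[ n ] k ≡ + n × n ℕ.< m
  -- With m a visible successor the product reduces to a negative integer, so the lower bound is
  -- absurd.
  quotient-bounds m@(suc _) -[1+ k ] () _
  quotient-bounds m@(suc _) (+ k) _ upper = k , refl , ℕ.≰⇒> λ m≤k → 8≰6
    (*-cancelʳ-≤-pos (+ 8) (+ 6) (+ m)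
      (≤-trans (*-monoˡ-≤-nonNeg (+ 8) (+≤+ m≤k))
               (*-cancelˡ-≤-pos (+ 8 * + k) (+ 6 * + m) (+ m)
                 (subst₂ _≤_ (swap (+ 8) (+ m) (+ k)) (swap (+ 6) (+ m) (+ m)) upper))))
    where
    swap : ∀ i m k → i * (m * k) ≡ m * (i * k)
    swap = solve-∀
    8≰6 : + 8 ≤ + 6 → ⊥
    8≰6 (+≤+ (s≤s (s≤s (s≤s (s≤s (s≤s (s≤s ())))))))

  -- One integer k = p - Tr(x ȳ) + m N(y) governs two elements: N(x - m y) = m k and N(p - x ȳ) = k
  -- p. The Euclidean bound on the first gives 0 ≤ k < m; k = 0 leads to m ∣ p, and otherwise the
  -- second element continues the descent.
  descent-step : ∀ m .{{_ : ℕ.NonZero m}} p x → norm x ≡ + m * + p →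
    m ℕ.∣ p ⊎ ∃[ n ] 0 ℕ.< n × n ℕ.< m × ∃[ z ] norm z ≡ + n * + p
  descent-step m p x eq = step (euclidean m x)
    where
    quotient : ℤ → ℤ → ℤ
    quotient n t = + p - t + + m * n
    factor₁ : ∀ m p n t → m * p + m * (m * n - t) ≡ m * (p - t + m * n)
    factor₁ = solve-∀
    factor₂ : ∀ m p n t → m * p * n + p * (p - t) ≡ (p - t + m * n) * p
    factor₂ = solve-∀
    remainder-norm : ∀ y → norm (x ⊟ + m • y) ≡ + m * quotient (norm y) (polar x y)
    remainder-norm y = trans (norm-⊟• (+ m) x y)
      (trans (cong (_+ + m * (+ m * norm y - polar x y)) eq)
             (factor₁ (+ m) (+ p) (norm y) (polar x y)))
    successor-norm : ∀ y → norm (coords (+ p) 0ℤ 0ℤ 0ℤ ⊟ x ⊠ conj y) ≡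
      quotient (norm y) (polar x y) * + p
    successor-norm y = trans (norm-⊟⊠conj (+ p) x y)
      (trans (cong (λ n → n * norm y + + p * (+ p - polar x y)) eq)
             (factor₂ (+ m) (+ p) (norm y) (polar x y)))
    Result : Set
    Result = m ℕ.∣ p ⊎ ∃[ n ] 0 ℕ.< n × n ℕ.< m × ∃[ z ] norm z ≡ + n * + p
    -- The quotient is a variable here, so that its equation with `+ n` can be matched by `refl`.
    classify : ∀ y k → norm (x ⊟ + m • y) ≡ + m * k →
      norm (coords (+ p) 0ℤ 0ℤ 0ℤ ⊟ x ⊠ conj y) ≡ k * + p →
      ∃[ n ] k ≡ + n × n ℕ.< m → Result
    classify y _ r≡ z≡ (zero , refl , _) =
      inj₁ (norm≡0⇒∣ m p x y eq (trans r≡ (*-zeroʳ (+ m))))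
    classify y _ r≡ z≡ (suc n , refl , n<m) =
      inj₂ (suc n , z<s , n<m , coords (+ p) 0ℤ 0ℤ 0ℤ ⊟ x ⊠ conj y , z≡)
    step : ∃[ y ] + 8 * norm (x ⊟ + m • y) ≤ + 6 * (+ m * + m) → Result
    step (y , upper) = classify y k (remainder-norm y) (successor-norm y) (quotient-bounds m k
      (subst (0ℤ ≤_) (cong (+ 8 *_) (remainder-norm y)) (norm-nonNeg (x ⊟ + m • y)))
      (subst (_≤ + 6 * (+ m * + m)) (cong (+ 8 *_) (remainder-norm y)) upper))
      where
      k : ℤ
      k = quotient (norm y) (polar x y)

  -- A divisor m of p with m < p is 1, and then x itself has norm p. In the other case the multiple
  -- has dropped, and the recursion follows the accessibility of m.
  descent : ∀ {p} → Prime p → ∀ m → Acc ℕ._<_ m → 0 ℕ.< m → m ℕ.< p →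
    ∀ x → norm x ≡ + m * + p → ∃[ y ] norm y ≡ + p
  descent {p} pr m (acc rec) 0<m m<p x eq =
    [ terminate ∘ prime⇒irreducible pr , continue ]′ (descent-step m {{ℕ.>-nonZero 0<m}} p x eq)
    where
    Result : Set
    Result = ∃[ y ] norm y ≡ + p
    terminate : m ≡ 1 ⊎ m ≡ p → Result
    terminate (inj₁ m≡1) = x , trans eq (trans (cong (λ m → + m * + p) m≡1) (*-identityˡ (+ p)))
    terminate (inj₂ m≡p) = contradiction m≡p (ℕ.<⇒≢ m<p)
    continue : ∃[ n ] 0 ℕ.< n × n ℕ.< m × ∃[ z ] norm z ≡ + n * + p → Result
    continue (n , 0<n , n<m , z , z≡) = descent pr n (rec n<m) 0<n (ℕ.<-trans n<m m<p) z z≡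

  -- A norm m p with 0 < m < p, by the pigeonhole principle.

  %-≡⇒∣ : ∀ m n p .{{_ : ℕ.NonZero p}} → m % p ≡ n % p → + p ∣ + m - + n
  %-≡⇒∣ m n p eq = divides (+ (m ℕ./ p) - + (n ℕ./ p)) (begin
    + m - + n
      ≡⟨ cong₂ _-_ (expand m) (trans (expand n) (cong (λ r → + r + + (n ℕ./ p) * + p) (sym eq))) ⟩
    (+ (m % p) + + (m ℕ./ p) * + p) - (+ (m % p) + + (n ℕ./ p) * + p)
      ≡⟨ lemma (+ (m % p)) (+ (m ℕ./ p)) (+ (n ℕ./ p)) (+ p) ⟩
    (+ (m ℕ./ p) - + (n ℕ./ p)) * + p ∎)
    where
    open ≡-Reasoning
    expand : ∀ m → + m ≡ + (m % p) + + (m ℕ./ p) * + p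
    expand m = trans (cong +_ (m≡m%n+[m/n]*n m p)) (cong (λ n → + (m % p) + n) (pos-* (m ℕ./ p) p))
    lemma : ∀ r q q′ p → (r + q * p) - (r + q′ * p) ≡ (q - q′) * p
    lemma = solve-∀

  euclid : ∀ {p} → Prime p → ∀ i j → + p ∣ i * j → (+ p ∣ i) ⊎ (+ p ∣ j)
  euclid pr i j p∣ij with euclidsLemma ∣ i ∣ ∣ j ∣ pr (subst (_ ℕ.∣_) (abs-* i j) (∣⇒∣ᵤ p∣ij))
  ... | inj₁ p∣i = inj₁ (∣ᵤ⇒∣ p∣i)
  ... | inj₂ p∣j = inj₂ (∣ᵤ⇒∣ p∣j)

  ∣∧<⇒≡0 : ∀ {p} i → ∣ i ∣ ℕ.< p → + p ∣ i → i ≡ 0ℤ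
  ∣∧<⇒≡0 i i<p p∣i with ∣ i ∣ in eq
  ... | zero  = ∣i∣≡0⇒i≡0 eq
  ... | suc n = contradiction (subst (_ ℕ.∣_) eq (∣⇒∣ᵤ p∣i)) (ℕ.>⇒∤ i<p)

  -- The prime divides one factor of (i - j)(i + j). Both are below p in absolute value, so that
  -- factor is 0, and i + j = 0 also gives i = j for naturals.
  squares-distinct : ∀ {p} → Prime p → ∀ i j → i ℕ.+ j ℕ.< p →
    + p ∣ + i * + i - + j * + j → i ≡ j
  squares-distinct {p} pr i j i+j<p p∣
    with euclid pr (+ i - + j) (+ i + + j) (subst (+ p ∣_) (lemma (+ i) (+ j)) p∣)
    where
    lemma : ∀ i j → i * i - j * j ≡ (i - j) * (i + j)
    lemma = solve-∀
  ... | inj₁ p∣i-j = +-injective (i-j≡0⇒i≡j (+ i) (+ j)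
    (∣∧<⇒≡0 (+ i - + j) (ℕ.≤-<-trans (∣i-j∣≤∣i∣+∣j∣ (+ i) (+ j)) i+j<p) p∣i-j))
  ... | inj₂ p∣i+j = trans (ℕ.m+n≡0⇒m≡0 i i+j≡0) (sym (ℕ.m+n≡0⇒n≡0 i i+j≡0))
    where
    i+j≡0 : i ℕ.+ j ≡ 0
    i+j≡0 = +-injective (∣∧<⇒≡0 (+ i + + j) i+j<p p∣i+j)

  -- The k + 1 numbers x² and the k + 1 numbers -1 - 2 y² are 2 k + 2 values modulo p = 2 k + 1, so
  -- two agree. Within either family the values are distinct modulo p, so the agreement is between
  -- the families.
  odd-prime-∣-sum : ∀ k → let p = suc (2 ℕ.* k) in Prime p →
    ∃[ x ] ∃[ y ] x ℕ.≤ k × y ℕ.≤ k × + p ∣ + x * + x + + 1 + + 2 * (+ y * + y)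
  odd-prime-∣-sum k pr = conclude (Fin.pigeonhole p<k+k (λ i → fromℕ< (m%n<n (f i) p)))
    where
    p : ℕ
    p = suc (2 ℕ.* k)
    value : Fin (suc k) ⊎ Fin (suc k) → ℕ
    value (inj₁ x) = toℕ x ℕ.* toℕ x
    -- 2k ≡ −1 (mod p), so this is −1 − 2y² without a subtraction.
    value (inj₂ y) = 2 ℕ.* k ℕ.* (1 ℕ.+ 2 ℕ.* (toℕ y ℕ.* toℕ y))
    f : Fin (suc k ℕ.+ suc k) → ℕ
    f i = value (splitAt (suc k) i)
    p<k+k : p ℕ.< suc k ℕ.+ suc k
    p<k+k = s<s (subst (ℕ._< k ℕ.+ suc k) (cong (k ℕ.+_) (sym (ℕ.+-identityʳ k)))
      (ℕ.+-monoʳ-< k (ℕ.n<1+n k)))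
    ≤k : (x : Fin (suc k)) → toℕ x ℕ.≤ k
    ≤k x = ℕ.s≤s⁻¹ (Fin.toℕ<n x)
    x+y<p : (x y : Fin (suc k)) → toℕ x ℕ.+ toℕ y ℕ.< p
    x+y<p x y = s<s (ℕ.+-mono-≤ (≤k x) (subst (toℕ y ℕ.≤_) (sym (ℕ.+-identityʳ k)) (≤k y)))
    value₁ : ∀ x → + value (inj₁ x) ≡ + toℕ x * + toℕ x
    value₁ x = pos-* (toℕ x) (toℕ x)
    value₂ : ∀ y → + value (inj₂ y) ≡ (+ p - 1ℤ) * (1ℤ + + 2 * (+ toℕ y * + toℕ y))
    value₂ y = begin
      + (2 ℕ.* k ℕ.* (1 ℕ.+ 2 ℕ.* (toℕ y ℕ.* toℕ y)))
        ≡⟨ pos-* (2 ℕ.* k) _ ⟩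
      + (2 ℕ.* k) * (1ℤ + + (2 ℕ.* (toℕ y ℕ.* toℕ y)))
        ≡⟨ cong (λ n → + (2 ℕ.* k) * (1ℤ + n))
             (trans (pos-* 2 (toℕ y ℕ.* toℕ y)) (cong (+ 2 *_) (pos-* (toℕ y) (toℕ y)))) ⟩
      + (2 ℕ.* k) * (1ℤ + + 2 * (+ toℕ y * + toℕ y)) ∎
      where open ≡-Reasoning
    p∤2 : ∀ k → Prime (suc (2 ℕ.* k)) → suc (2 ℕ.* k) ℕ.∣ 2 → ⊥
    p∤2 zero    prime₁ _   = ¬prime[1] prime₁
    p∤2 (suc n) _      p∣2 = ℕ.>⇒∤ (s<s (ℕ.*-monoʳ-≤ 2 (s≤s (z≤n {n})))) p∣2
    mixed : ∀ p s t → s - (p - 1ℤ) * (1ℤ + t) ≡ s + 1ℤ + t - (1ℤ + t) * p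
    mixed = solve-∀
    Goal : Set
    Goal = ∃[ x ] ∃[ y ] x ℕ.≤ k × y ℕ.≤ k × + p ∣ + x * + x + + 1 + + 2 * (+ y * + y)
    -- Adding (1 + 2 y²) p to the difference of the two values leaves x² + 1 + 2 y².
    found : ∀ x y → + p ∣ + value (inj₁ x) - + value (inj₂ y) → Goal
    found x y p∣ = toℕ x , toℕ y , ≤k x , ≤k y , subst (+ p ∣_) (cancel _ _)
      (∣m∣n⇒∣m+n
         (subst (+ p ∣_) (trans (cong₂ _-_ (value₁ x) (value₂ y))
           (mixed (+ p) (+ toℕ x * + toℕ x) (+ 2 * (+ toℕ y * + toℕ y)))) p∣)
         (∣n⇒∣m*n (1ℤ + + 2 * (+ toℕ y * + toℕ y)) ∣-refl))
      where
      cancel : ∀ i j → i - j + j ≡ i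
      cancel = solve-∀
    distinct : ∀ x y → + p ∣ + toℕ x * + toℕ x - + toℕ y * + toℕ y → x ≡ y
    distinct x y = Fin.toℕ-injective ∘ squares-distinct pr (toℕ x) (toℕ y) (x+y<p x y)
    halve : ∀ i → + p ∣ + 2 * i → + p ∣ i
    halve i p∣2i with euclid pr (+ 2) i p∣2i
    ... | inj₁ p∣2 = ⊥-elim (p∤2 k pr (∣⇒∣ᵤ p∣2))
    ... | inj₂ p∣i = p∣i
    collide : ∀ u v → u ≢ v → + p ∣ + value u - + value v → Goal
    collide (inj₁ x) (inj₁ y) x≢y p∣ = contradiction
      (cong inj₁ (distinct x y (subst (+ p ∣_) (cong₂ _-_ (value₁ x) (value₁ y)) p∣))) x≢y
    -- The factor p - 1 acts as -1 modulo p, so p divides 2 (s - t), and p is odd.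
    collide (inj₂ x) (inj₂ y) x≢y p∣ = contradiction
      (cong inj₂ (distinct x y (halve (s - t) (subst (+ p ∣_) (rest (+ p) s t)
        (∣m∣n⇒∣m-n (∣n⇒∣m*n (+ 2 * (s - t)) ∣-refl)
          (subst (+ p ∣_) (cong₂ _-_ (value₂ x) (value₂ y)) p∣)))))) x≢y
      where
      s t : ℤ
      s = + toℕ x * + toℕ x
      t = + toℕ y * + toℕ y
      rest : ∀ p s t → + 2 * (s - t) * p - ((p - 1ℤ) * (1ℤ + + 2 * s) - (p - 1ℤ) * (1ℤ + + 2 * t)) ≡
        + 2 * (s - t)
      rest = solve-∀
    collide (inj₁ x) (inj₂ y) _ p∣ = found x y p∣
    collide (inj₂ y) (inj₁ x) _ p∣ = found x y
      (subst (+ p ∣_) (negate (+ value (inj₂ y)) (+ value (inj₁ x))) (∣m⇒∣-m p∣))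
      where
      negate : ∀ i j → - (i - j) ≡ j - i
      negate = solve-∀
    reduced : Fin (suc k ℕ.+ suc k) → Fin p
    reduced i = fromℕ< (m%n<n (f i) p)
    conclude : ∃[ i ] ∃[ j ] i Fin.< j × reduced i ≡ reduced j → Goal
    conclude (i , j , i<j , eq) = collide (splitAt (suc k) i) (splitAt (suc k) j)
      -- Since `join` inverts `splitAt`, distinct indices stay distinct after splitting.
      (λ s≡ → Fin.<⇒≢ i<j (trans (sym (Fin.join-splitAt (suc k) (suc k) i))
        (trans (cong (join (suc k) (suc k)) s≡) (Fin.join-splitAt (suc k) (suc k) j))))
      (%-≡⇒∣ (f i) (f j) p (trans (sym (Fin.toℕ-fromℕ< (m%n<n (f i) p)))
        (trans (cong toℕ eq) (Fin.toℕ-fromℕ< (m%n<n (f j) p)))))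

  -- The sum is at most 3 k² + 1, which falls short of (2 k + 1)² by k² + 4 k; its summand 1 keeps m
  -- positive.
  multiple-bounds : ∀ k x y m → 0 ℕ.< k → x ℕ.≤ k → y ℕ.≤ k →
    x ℕ.* x ℕ.+ 1 ℕ.+ 2 ℕ.* (y ℕ.* y) ≡ m ℕ.* suc (2 ℕ.* k) →
    0 ℕ.< m × m ℕ.< suc (2 ℕ.* k)
  multiple-bounds k x y m 0<k x≤k y≤k eq = 0<m m eq ,
    ℕ.*-cancelʳ-< (suc (2 ℕ.* k)) m (suc (2 ℕ.* k)) (begin-strict
    m ℕ.* suc (2 ℕ.* k)                             ≡⟨ eq ⟨
    x ℕ.* x ℕ.+ 1 ℕ.+ 2 ℕ.* (y ℕ.* y)
      ≤⟨ ℕ.+-mono-≤ (ℕ.+-monoˡ-≤ 1 (ℕ.*-mono-≤ x≤k x≤k)) (ℕ.*-monoʳ-≤ 2 (ℕ.*-mono-≤ y≤k y≤k)) ⟩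
    k ℕ.* k ℕ.+ 1 ℕ.+ 2 ℕ.* (k ℕ.* k)               <⟨ ℕ.m<m+n _ (ℕ.≤-trans 0<k (ℕ.m≤m+n k _)) ⟩
    k ℕ.* k ℕ.+ 1 ℕ.+ 2 ℕ.* (k ℕ.* k) ℕ.+ (k ℕ.+ (3 ℕ.* k ℕ.+ k ℕ.* k)) ≡⟨ square k ⟩
    suc (2 ℕ.* k) ℕ.* suc (2 ℕ.* k)                 ∎)
    where
    open ℕ.≤-Reasoning
    square : ∀ k → k ℕ.* k ℕ.+ 1 ℕ.+ 2 ℕ.* (k ℕ.* k) ℕ.+ (k ℕ.+ (3 ℕ.* k ℕ.+ k ℕ.* k)) ≡
      (1 ℕ.+ 2 ℕ.* k) ℕ.* (1 ℕ.+ 2 ℕ.* k)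
    square = ℕ.solve-∀
    0<m : ∀ m → x ℕ.* x ℕ.+ 1 ℕ.+ 2 ℕ.* (y ℕ.* y) ≡ m ℕ.* suc (2 ℕ.* k) → 0 ℕ.< m
    0<m zero    eq₀ = contradiction (ℕ.m+n≡0⇒n≡0 (x ℕ.* x) (ℕ.m+n≡0⇒m≡0 (x ℕ.* x ℕ.+ 1) eq₀)) λ ()
    0<m (suc _) _   = z<s

  prime-divides-norm : ∀ {p} → Prime p →
    ∃[ m ] 0 ℕ.< m × m ℕ.< p × ∃[ x ] norm x ≡ + m * + p
  prime-divides-norm {p} pr with p % 2 in p%2≡ | m≡m%n+[m/n]*n p 2 | m%n<n p 2
  ... | zero  | _  | _ with prime⇒irreducible pr (ℕ.m%n≡0⇒n∣m p 2 p%2≡)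
  -- The only even prime is 2 = N(1 + 𝐢).
  ...   | inj₂ refl = 1 , z<s , s<s z<s , coords 1ℤ 1ℤ 0ℤ 0ℤ , refl
  prime-divides-norm {p} pr | suc (suc _) | _  | s≤s (s≤s ())
  prime-divides-norm {p} pr | suc zero | p≡ | _ =
    subst Goal (sym p≡2k+1) (odd (p ℕ./ 2) (subst Prime p≡2k+1 pr))
    where
    Goal : ℕ → Set
    Goal p = ∃[ m ] 0 ℕ.< m × m ℕ.< p × ∃[ x ] norm x ≡ + m * + p
    p≡2k+1 : p ≡ suc (2 ℕ.* (p ℕ./ 2))
    p≡2k+1 = trans p≡ (cong suc (ℕ.*-comm (p ℕ./ 2) 2))
    pos-sum : ∀ x y → + x * + x + + 1 + + 2 * (+ y * + y) ≡ + (x ℕ.* x ℕ.+ 1 ℕ.+ 2 ℕ.* (y ℕ.* y))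
    pos-sum x y = sym (cong₂ (λ i j → i + + 1 + j) (pos-* x x)
      (trans (pos-* 2 (y ℕ.* y)) (cong (+ 2 *_) (pos-* y y))))
    -- x + 𝐢 + y √2 𝐣, where √2 𝐣 = 2 v₃ − v₁ − v₂.
    norm-sum : ∀ x y → norm (coords (x - y) (1ℤ - y) (+ 2 * y) 0ℤ) ≡ x * x + + 1 + + 2 * (y * y)
    norm-sum = lemma
      where
      lemma : ∀ x y → (x - y) * (x - y) + (1ℤ - y) * (1ℤ - y) +
        (x - y + (1ℤ - y)) * (+ 2 * y + 0ℤ) + + 2 * y * (+ 2 * y) + + 2 * y * 0ℤ + 0ℤ * 0ℤ ≡
        x * x + + 1 + + 2 * (y * y)
      lemma = solve-∀
    0<k : ∀ k → Prime (suc (2 ℕ.* k)) → 0 ℕ.< k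
    0<k zero    prime₁ = ⊥-elim (¬prime[1] prime₁)
    0<k (suc _) _      = z<s
    odd : ∀ k → Prime (suc (2 ℕ.* k)) → Goal (suc (2 ℕ.* k))
    odd k pr′ with odd-prime-∣-sum k pr′
    ... | x , y , x≤k , y≤k , p∣ with ∣⇒∣ᵤ (subst (+ suc (2 ℕ.* k) ∣_) (pos-sum x y) p∣)
    ...   | ℕ.divides m eq =
      m , proj₁ bounds , proj₂ bounds , coords (+ x - + y) (1ℤ - + y) (+ 2 * + y) 0ℤ ,
      trans (norm-sum (+ x) (+ y)) (trans (pos-sum x y)
        (trans (cong +_ eq) (pos-* m (suc (2 ℕ.* k)))))
      where
      bounds : 0 ℕ.< m × m ℕ.< suc (2 ℕ.* k)
      bounds = multiple-bounds k x y m (0<k k pr′) x≤k y≤k eq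

  prime-is-norm : ∀ {p} → Prime p → ∃[ x ] norm x ≡ + p
  prime-is-norm pr =
    let m , 0<m , m<p , x , eq = prime-divides-norm pr
    in descent pr m (<-wellFounded m) 0<m m<p x eq

  -- A rational prime may be negative. Its sign ε goes to the conjugate factor, and the last
  -- equation, an instance of ε² = 1, keeps the norm of that factor equal to ∣p∣.
  sign-decomposition : ∀ p → ∃[ ε ] p ≡ ε * + ∣ p ∣ × + ∣ p ∣ ≡ ε * (ε * + ∣ p ∣)
  sign-decomposition (+ n)    = 1ℤ , p≡ , trans p≡ (cong (1ℤ *_) p≡)
    where
    p≡ : + n ≡ 1ℤ * + n
    p≡ = sym (*-identityˡ (+ n))
  sign-decomposition -[1+ n ] = -1ℤ , p≡ , trans (sym (-1*i≡-i -[1+ n ])) (cong (-1ℤ *_) p≡)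
    where
    p≡ : -[1+ n ] ≡ -1ℤ * + ℕ.suc n
    p≡ = sym (-1*i≡-i (+ ℕ.suc n))

-- Transfer to quaternions with coordinates in ℚ(√2).

module Rational where

  open import Data.Rational.Base using (ℚ; 0ℚ; 1ℚ; ½; _/_; _+_; _*_; _-_; -_; toℚᵘ)
  open import Data.Rational.Properties
  open import Data.Rational.Solver using (module +-*-Solver)
  open import Data.Rational.Unnormalised.Base as ℚᵘ using (mkℚᵘ; *≡*)
  import Data.Rational.Unnormalised.Properties as ℚᵘ
  open +-*-Solver
  open Integral using (Coords; coords; norm; conj; _•_)

  ι : ℤ → ℚ
  ι n = n / 1

  ι-injective : ∀ {m n} → ι m ≡ ι n → m ≡ n
  ι-injective {m} {n} eq with fromℚᵘ-injective {mkℚᵘ m 0} {mkℚᵘ n 0} eq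
  ... | *≡* eq′ = trans (sym (ℤ.*-identityʳ m)) (trans eq′ (ℤ.*-identityʳ n))

  -- The comparison takes place among unnormalised fractions, where it becomes an equation in ℤ.
  ι-+ : ∀ m n → ι (m ℤ.+ n) ≡ ι m + ι n
  ι-+ m n = toℚᵘ-injective (begin
    toℚᵘ (ι (m ℤ.+ n))       ≈⟨ toℚᵘ-fromℚᵘ (mkℚᵘ (m ℤ.+ n) 0) ⟩
    mkℚᵘ (m ℤ.+ n) 0         ≈⟨ *≡* (lemma m n) ⟩
    mkℚᵘ m 0 ℚᵘ.+ mkℚᵘ n 0   ≈⟨ ℚᵘ.+-cong (toℚᵘ-fromℚᵘ (mkℚᵘ m 0)) (toℚᵘ-fromℚᵘ (mkℚᵘ n 0)) ⟨
    toℚᵘ (ι m) ℚᵘ.+ toℚᵘ (ι n) ≈⟨ toℚᵘ-homo-+ (ι m) (ι n) ⟨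
    toℚᵘ (ι m + ι n)         ∎)
    where
    open ℚᵘ.≃-Reasoning
    lemma : ∀ m n → (m ℤ.+ n) ℤ.* + 1 ≡ (m ℤ.* + 1 ℤ.+ n ℤ.* + 1) ℤ.* + 1
    lemma = ℤ.solve-∀

  ι-* : ∀ m n → ι (m ℤ.* n) ≡ ι m * ι n
  ι-* m n = toℚᵘ-injective (begin
    toℚᵘ (ι (m ℤ.* n))       ≈⟨ toℚᵘ-fromℚᵘ (mkℚᵘ (m ℤ.* n) 0) ⟩
    mkℚᵘ m 0 ℚᵘ.* mkℚᵘ n 0   ≈⟨ ℚᵘ.*-cong (toℚᵘ-fromℚᵘ (mkℚᵘ m 0)) (toℚᵘ-fromℚᵘ (mkℚᵘ n 0)) ⟨
    toℚᵘ (ι m) ℚᵘ.* toℚᵘ (ι n) ≈⟨ toℚᵘ-homo-* (ι m) (ι n) ⟨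
    toℚᵘ (ι m * ι n)         ∎)
    where open ℚᵘ.≃-Reasoning

  -- Rationals and rational multiples of √2 grade ℚ(√2) by parity; the four product rules that
  -- follow are the multiplication table.
  fromℚ√2 : ℚ → ℚ√2
  fromℚ√2 q = 0ℚ + q ·√2

  fromℚ-* : ∀ x y → fromℚ x *ₖ fromℚ y ≡ fromℚ (x * y)
  fromℚ-* x y = cong₂ _+_·√2
    (solve 2 (λ x y → x :* y :+ con (1ℚ + 1ℚ) :* (con 0ℚ :* con 0ℚ) := x :* y) refl x y)
    (solve 2 (λ x y → x :* con 0ℚ :+ con 0ℚ :* y := con 0ℚ) refl x y)

  fromℚ-*√2 : ∀ x y → fromℚ x *ₖ fromℚ√2 y ≡ fromℚ√2 (x * y)
  fromℚ-*√2 x y = cong₂ _+_·√2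
    (solve 2 (λ x y → x :* con 0ℚ :+ con (1ℚ + 1ℚ) :* (con 0ℚ :* y) := con 0ℚ) refl x y)
    (solve 2 (λ x y → x :* y :+ con 0ℚ :* con 0ℚ := x :* y) refl x y)

  fromℚ√2-* : ∀ x y → fromℚ√2 x *ₖ fromℚ y ≡ fromℚ√2 (x * y)
  fromℚ√2-* x y = cong₂ _+_·√2
    (solve 2 (λ x y → con 0ℚ :* y :+ con (1ℚ + 1ℚ) :* (x :* con 0ℚ) := con 0ℚ) refl x y)
    (solve 2 (λ x y → con 0ℚ :* con 0ℚ :+ x :* y := x :* y) refl x y)

  fromℚ√2-*√2 : ∀ x y → fromℚ√2 x *ₖ fromℚ√2 y ≡ fromℚ ((1ℚ + 1ℚ) * (x * y))
  fromℚ√2-*√2 x y = cong₂ _+_·√2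
    (solve 2 (λ x y → con 0ℚ :* con 0ℚ :+ con (1ℚ + 1ℚ) :* (x :* y) :=
      con (1ℚ + 1ℚ) :* (x :* y)) refl x y)
    (solve 2 (λ x y → con 0ℚ :* y :+ x :* con 0ℚ := con 0ℚ) refl x y)

  cong₄ : ∀ {A B C D E : Set} (f : A → B → C → D → E) {a a′ b b′ c c′ d d′} →
    a ≡ a′ → b ≡ b′ → c ≡ c′ → d ≡ d′ → f a b c d ≡ f a′ b′ c′ d′
  cong₄ f refl refl refl refl = refl

  -- All elements of H₁₂₂ have this shape and products preserve it, so four rationals suffice for
  -- the computations.
  quaternion : ℚ → ℚ → ℚ → ℚ → ℍ
  quaternion r s t u = ⟨ fromℚ r , fromℚ s , fromℚ√2 t , fromℚ√2 u ⟩

  ·-quaternion : ∀ x r s t u →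
    fromℚ x · quaternion r s t u ≡ quaternion (x * r) (x * s) (x * t) (x * u)
  ·-quaternion x r s t u =
    cong₄ ⟨_,_,_,_⟩ (fromℚ-* x r) (fromℚ-* x s) (fromℚ-*√2 x t) (fromℚ-*√2 x u)

  2ℚ : ℚ
  2ℚ = 1ℚ + 1ℚ

  quaternion-* : ∀ r s t u r′ s′ t′ u′ →
    quaternion r s t u ℍ.* quaternion r′ s′ t′ u′ ≡ quaternion
      (r * r′ - s * s′ - 2ℚ * (t * t′) - 2ℚ * (u * u′))
      (r * s′ + s * r′ + 2ℚ * (t * u′) - 2ℚ * (u * t′))
      (r * t′ - s * u′ + t * r′ + u * s′)
      (r * u′ + s * t′ - t * s′ + u * r′)
  quaternion-* r s t u r′ s′ t′ u′ = cong₄ ⟨_,_,_,_⟩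
    (cong₄ (λ w x y z → w -ₖ x -ₖ y -ₖ z)
      (fromℚ-* r r′) (fromℚ-* s s′) (fromℚ√2-*√2 t t′) (fromℚ√2-*√2 u u′))
    (cong₄ (λ w x y z → w +ₖ x +ₖ y -ₖ z)
      (fromℚ-* r s′) (fromℚ-* s r′) (fromℚ√2-*√2 t u′) (fromℚ√2-*√2 u t′))
    (cong₄ (λ w x y z → w -ₖ x +ₖ y +ₖ z)
      (fromℚ-*√2 r t′) (fromℚ-*√2 s u′) (fromℚ√2-* t r′) (fromℚ√2-* u s′))
    (cong₄ (λ w x y z → w +ₖ x -ₖ y +ₖ z)
      (fromℚ-*√2 r u′) (fromℚ-*√2 s t′) (fromℚ√2-* t s′) (fromℚ√2-* u r′))

  normℚ : ℚ → ℚ → ℚ → ℚ → ℚ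
  normℚ r s t u = r * r + s * s + 2ℚ * (t * t) + 2ℚ * (u * u)

  -- Euler's four-square identity with the last two variables scaled by √2.
  normℚ-* : ∀ r s t u r′ s′ t′ u′ →
    normℚ (r * r′ - s * s′ - 2ℚ * (t * t′) - 2ℚ * (u * u′))
          (r * s′ + s * r′ + 2ℚ * (t * u′) - 2ℚ * (u * t′))
          (r * t′ - s * u′ + t * r′ + u * s′)
          (r * u′ + s * t′ - t * s′ + u * r′) ≡
    normℚ r s t u * normℚ r′ s′ t′ u′
  normℚ-* = solve 8 (λ r s t u r′ s′ t′ u′ →
    let two = con 2ℚ
        q = λ r s t u → r :* r :+ s :* s :+ two :* (t :* t) :+ two :* (u :* u)
    in
    q (r :* r′ :- s :* s′ :- two :* (t :* t′) :- two :* (u :* u′))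
      (r :* s′ :+ s :* r′ :+ two :* (t :* u′) :- two :* (u :* t′))
      (r :* t′ :- s :* u′ :+ t :* r′ :+ u :* s′)
      (r :* u′ :+ s :* t′ :- t :* s′ :+ u :* r′) :=
    q r s t u :* q r′ s′ t′ u′) refl

  lift-+ : ∀ m n {x y} → ι m ≡ x → ι n ≡ y → ι (m ℤ.+ n) ≡ x + y
  lift-+ m n m≡ n≡ = trans (ι-+ m n) (cong₂ _+_ m≡ n≡)

  lift-* : ∀ m n {x y} → ι m ≡ x → ι n ≡ y → ι (m ℤ.* n) ≡ x * y
  lift-* m n m≡ n≡ = trans (ι-* m n) (cong₂ _*_ m≡ n≡)

  ι-neg : ∀ n → ι (ℤ.- n) ≡ - ι n
  ι-neg n = begin
    ι (ℤ.- n)        ≡⟨ cong ι (ℤ.-1*i≡-i n) ⟨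
    ι (-1ℤ ℤ.* n)    ≡⟨ ι-* -1ℤ n ⟩
    - 1ℚ * ι n       ≡⟨ solve 1 (λ x → con (- 1ℚ) :* x := :- x) refl (ι n) ⟩
    - ι n            ∎
    where open ≡-Reasoning

  -- Written exactly as the sum in `_∈H₁₂₂`, so that membership holds by `refl`.
  embed : Coords → ℍ
  embed (coords a b c d) = a ·ℤ v₁ ℍ.+ b ·ℤ v₂ ℍ.+ c ·ℤ v₃ ℍ.+ d ·ℤ v₄

  embed-quaternion : ∀ a b c d → embed (coords a b c d) ≡ quaternion
    (ι a + ½ * (ι c + ι d)) (ι b + ½ * (ι c + ι d)) (½ * ι c) (½ * ι d)
  embed-quaternion a b c d = trans
    (cong₄ (λ w x y z → w ℍ.+ x ℍ.+ y ℍ.+ z)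
      -- The basis vectors are closed terms and evaluate to these rational coordinates.
      (·-quaternion (ι a) 1ℚ 0ℚ 0ℚ 0ℚ) (·-quaternion (ι b) 0ℚ 1ℚ 0ℚ 0ℚ)
      (·-quaternion (ι c) ½ ½ ½ 0ℚ) (·-quaternion (ι d) ½ ½ 0ℚ ½))
    (cong₄ quaternion
      (solve 4 (λ a b c d → a :* con 1ℚ :+ b :* con 0ℚ :+ c :* con ½ :+ d :* con ½ :=
                            a :+ con ½ :* (c :+ d)) refl (ι a) (ι b) (ι c) (ι d))
      (solve 4 (λ a b c d → a :* con 0ℚ :+ b :* con 1ℚ :+ c :* con ½ :+ d :* con ½ :=
                            b :+ con ½ :* (c :+ d)) refl (ι a) (ι b) (ι c) (ι d))
      (solve 4 (λ a b c d → a :* con 0ℚ :+ b :* con 0ℚ :+ c :* con ½ :+ d :* con 0ℚ :=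
                            con ½ :* c) refl (ι a) (ι b) (ι c) (ι d))
      (solve 4 (λ a b c d → a :* con 0ℚ :+ b :* con 0ℚ :+ c :* con 0ℚ :+ d :* con ½ :=
                            con ½ :* d) refl (ι a) (ι b) (ι c) (ι d)))

  -- The halves cancel, which identifies the integral form `norm` with the quaternion norm.
  normℚ-embed : ∀ a b c d →
    normℚ (ι a + ½ * (ι c + ι d)) (ι b + ½ * (ι c + ι d)) (½ * ι c) (½ * ι d) ≡
    ι (norm (coords a b c d))
  normℚ-embed a b c d = trans
    (solve 4 (λ a b c d →
       let r = a :+ con ½ :* (c :+ d) ; s = b :+ con ½ :* (c :+ d)
           t = con ½ :* c ; u = con ½ :* d
       in r :* r :+ s :* s :+ con 2ℚ :* (t :* t) :+ con 2ℚ :* (u :* u) :=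
          a :* a :+ b :* b :+ (a :+ b) :* (c :+ d) :+ c :* c :+ c :* d :+ d :* d)
       refl (ι a) (ι b) (ι c) (ι d))
    (sym
      (lift-+ (a ℤ.* a ℤ.+ b ℤ.* b ℤ.+ (a ℤ.+ b) ℤ.* (c ℤ.+ d) ℤ.+ c ℤ.* c ℤ.+ c ℤ.* d) (d ℤ.* d)
        (lift-+ (a ℤ.* a ℤ.+ b ℤ.* b ℤ.+ (a ℤ.+ b) ℤ.* (c ℤ.+ d) ℤ.+ c ℤ.* c) (c ℤ.* d)
          (lift-+ (a ℤ.* a ℤ.+ b ℤ.* b ℤ.+ (a ℤ.+ b) ℤ.* (c ℤ.+ d)) (c ℤ.* c)
            (lift-+ (a ℤ.* a ℤ.+ b ℤ.* b) ((a ℤ.+ b) ℤ.* (c ℤ.+ d))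
              (lift-+ (a ℤ.* a) (b ℤ.* b) (ι-* a a) (ι-* b b))
              (lift-* (a ℤ.+ b) (c ℤ.+ d) (ι-+ a b) (ι-+ c d)))
            (ι-* c c))
          (ι-* c d))
        (ι-* d d)))

  -- Confirms that `conj` is quaternion conjugation, here scaled by ε.
  embed-•-conj : ∀ ε a b c d → embed (ε • conj (coords a b c d)) ≡ quaternion
    (ι ε * (ι a + ½ * (ι c + ι d))) (- (ι ε * (ι b + ½ * (ι c + ι d))))
    (- (ι ε * (½ * ι c))) (- (ι ε * (½ * ι d)))
  embed-•-conj ε a b c d = trans
    (embed-quaternion (ε ℤ.* (a ℤ.+ c ℤ.+ d)) (ε ℤ.* ℤ.- b) (ε ℤ.* ℤ.- c) (ε ℤ.* ℤ.- d))
    (trans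
      (cong₄ (λ a b c d → quaternion (a + ½ * (c + d)) (b + ½ * (c + d)) (½ * c) (½ * d))
        (lift-* ε (a ℤ.+ c ℤ.+ d) refl (lift-+ (a ℤ.+ c) d (ι-+ a c) refl))
        (lift-* ε (ℤ.- b) refl (ι-neg b))
        (lift-* ε (ℤ.- c) refl (ι-neg c))
        (lift-* ε (ℤ.- d) refl (ι-neg d)))
      (cong₄ quaternion
        (solve 4 (λ e a c d → e :* (a :+ c :+ d) :+ con ½ :* (e :* :- c :+ e :* :- d) :=
                              e :* (a :+ con ½ :* (c :+ d))) refl (ι ε) (ι a) (ι c) (ι d))
        (solve 4 (λ e b c d → e :* :- b :+ con ½ :* (e :* :- c :+ e :* :- d) :=
                              :- (e :* (b :+ con ½ :* (c :+ d)))) refl (ι ε) (ι b) (ι c) (ι d))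
        (solve 2 (λ e c → con ½ :* (e :* :- c) := :- (e :* (con ½ :* c))) refl (ι ε) (ι c))
        (solve 2 (λ e d → con ½ :* (e :* :- d) := :- (e :* (con ½ :* d))) refl (ι ε) (ι d))))

  quaternion-*-conj : ∀ e r s t u →
    quaternion r s t u ℍ.* quaternion (e * r) (- (e * s)) (- (e * t)) (- (e * u)) ≡
    quaternion (e * normℚ r s t u) 0ℚ 0ℚ 0ℚ
  quaternion-*-conj e r s t u = trans
    (quaternion-* r s t u (e * r) (- (e * s)) (- (e * t)) (- (e * u)))
    (cong₄ quaternion
      (solve 5 (λ e r s t u →
        r :* (e :* r) :- s :* :- (e :* s) :- con 2ℚ :* (t :* :- (e :* t))
        :- con 2ℚ :* (u :* :- (e :* u)) :=
        e :* (r :* r :+ s :* s :+ con 2ℚ :* (t :* t) :+ con 2ℚ :* (u :* u))) refl e r s t u)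
      (solve 5 (λ e r s t u →
        r :* :- (e :* s) :+ s :* (e :* r) :+ con 2ℚ :* (t :* :- (e :* u))
        :- con 2ℚ :* (u :* :- (e :* t)) :=
        con 0ℚ) refl e r s t u)
      (solve 5 (λ e r s t u →
        r :* :- (e :* t) :- s :* :- (e :* u) :+ t :* (e :* r) :+ u :* :- (e :* s) :=
        con 0ℚ) refl e r s t u)
      (solve 5 (λ e r s t u →
        r :* :- (e :* u) :+ s :* :- (e :* t) :- t :* :- (e :* s) :+ u :* (e :* r) :=
        con 0ℚ) refl e r s t u))

  fromℤ-quaternion : ∀ n → fromℤ n ≡ quaternion (ι n) 0ℚ 0ℚ 0ℚ
  fromℤ-quaternion n = trans (·-quaternion (ι n) 1ℚ 0ℚ 0ℚ 0ℚ)
    (cong₄ quaternion (*-identityʳ (ι n)) (*-zeroʳ (ι n)) (*-zeroʳ (ι n)) (*-zeroʳ (ι n)))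

  -- With N(x) = ∣p∣ and ε the sign of p this is the factorisation of p.
  embed-*-conj : ∀ ε x → embed x ℍ.* embed (ε • conj x) ≡ fromℤ (ε ℤ.* norm x)
  embed-*-conj ε (coords a b c d) = begin
    embed (coords a b c d) ℍ.* embed (ε • conj (coords a b c d))
      ≡⟨ cong₂ ℍ._*_ (embed-quaternion a b c d) (embed-•-conj ε a b c d) ⟩
    _ ≡⟨ quaternion-*-conj (ι ε) r s t u ⟩
    quaternion (ι ε * normℚ r s t u) 0ℚ 0ℚ 0ℚ
      ≡⟨ cong (λ n → quaternion n 0ℚ 0ℚ 0ℚ)
           (sym (lift-* ε (norm (coords a b c d)) refl (sym (normℚ-embed a b c d)))) ⟩
    quaternion (ι (ε ℤ.* norm (coords a b c d))) 0ℚ 0ℚ 0ℚ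
      ≡⟨ fromℤ-quaternion (ε ℤ.* norm (coords a b c d)) ⟨
    fromℤ (ε ℤ.* norm (coords a b c d)) ∎
    where
    open ≡-Reasoning
    r s t u : ℚ
    r = ι a + ½ * (ι c + ι d)
    s = ι b + ½ * (ι c + ι d)
    t = ½ * ι c
    u = ½ * ι d

  -- The norm is multiplicative over ℚ, and injectivity of `ι` brings the equation back to ℤ.
  inverse⇒norm-* : ∀ x y → embed x ℍ.* embed y ≡ 𝟏 → norm x ℤ.* norm y ≡ 1ℤ
  inverse⇒norm-* (coords a b c d) (coords e f g h) eq = ι-injective (begin
    ι (norm (coords a b c d) ℤ.* norm (coords e f g h))
      ≡⟨ lift-* (norm (coords a b c d)) (norm (coords e f g h))
           (sym (normℚ-embed a b c d)) (sym (normℚ-embed e f g h)) ⟩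
    normℚ r s t u * normℚ r′ s′ t′ u′
      ≡⟨ normℚ-* r s t u r′ s′ t′ u′ ⟨
    _ ≡⟨ norm-cong (trans (sym (quaternion-* r s t u r′ s′ t′ u′))
           (trans (sym (cong₂ ℍ._*_ (embed-quaternion a b c d) (embed-quaternion e f g h))) eq)) ⟩
    1ℚ ∎)
    where
    open ≡-Reasoning
    r s t u r′ s′ t′ u′ : ℚ
    r = ι a + ½ * (ι c + ι d)
    s = ι b + ½ * (ι c + ι d)
    t = ½ * ι c
    u = ½ * ι d
    r′ = ι e + ½ * (ι g + ι h)
    s′ = ι f + ½ * (ι g + ι h)
    t′ = ½ * ι g
    u′ = ½ * ι h
    -- Matching against the closed `𝟏` fixes all four coordinates by unification, and the norm
    -- evaluates to 1.
    norm-cong : ∀ {r s t u} → quaternion r s t u ≡ 𝟏 → normℚ r s t u ≡ 1ℚ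
    norm-cong refl = refl

  embed-∈ : ∀ x → embed x ∈H₁₂₂
  embed-∈ (coords a b c d) = a , b , c , d , refl

-- Nonunits of prime norm and the conclusion.

open Integral
open Rational using (embed; embed-∈; embed-*-conj; inverse⇒norm-*)

-- An inverse y would give N(x) N(y) = 1, so p would divide 1.
prime-norm⇒nonunit : ∀ {p} → Prime p → ∀ x → norm x ≡ + p → ¬ IsUnit (embed x)
prime-norm⇒nonunit {p} pr x norm≡p (_ , _ , (a , b , c , d , refl) , xy≡1 , _) =
  ¬prime[1] (subst Prime p≡1 pr)
  where
  open ≡-Reasoning
  n : ℤ
  n = norm (coords a b c d)
  p≡1 : p ≡ 1
  p≡1 = ℕ.m*n≡1⇒m≡1 p ∣ n ∣ (begin
    p ℕ.* ∣ n ∣         ≡⟨ ℤ.abs-* (+ p) n ⟨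
    ∣ + p ℤ.* n ∣       ≡⟨ cong (λ m → ∣ m ℤ.* n ∣) norm≡p ⟨
    ∣ norm x ℤ.* n ∣    ≡⟨ cong ∣_∣ (inverse⇒norm-* x (coords a b c d) xy≡1) ⟩
    1                   ∎)

theorem36 : (p : ℤ) → Prime ∣ p ∣ → ¬ IsPrime (fromℤ p)
theorem36 p pr isPrime = refute (prime-is-norm pr) (sign-decomposition p)
  where
  refute : ∃[ x ] norm x ≡ + ∣ p ∣ →
    ∃[ ε ] p ≡ ε ℤ.* + ∣ p ∣ × + ∣ p ∣ ≡ ε ℤ.* (ε ℤ.* + ∣ p ∣) → ⊥
  refute (x , norm≡) (ε , p≡ , ε²≡) =
    -- In p = x (ε x̄) both factors have norm ∣p∣, so `split` makes a unit of an element that cannot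
    -- be one.
    [ prime-norm⇒nonunit pr x norm≡ , prime-norm⇒nonunit pr (ε • conj x) conj-norm≡ ]′
      (IsPrime.split isPrime (embed x) (embed (ε • conj x)) (embed-∈ x) (embed-∈ (ε • conj x))
        (trans (cong fromℤ (trans p≡ (cong (ε ℤ.*_) (sym norm≡)))) (sym (embed-*-conj ε x))))
    where
    conj-norm≡ : norm (ε • conj x) ≡ + ∣ p ∣
    conj-norm≡ = trans (norm-• ε (conj x))
      (trans (cong (λ n → ε ℤ.* (ε ℤ.* n)) (trans (norm-conj x) norm≡)) (sym ε²≡))
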